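{- Let $\mathcal{I}=(G,\{r_i,F_i\}_{i\in[N]})$ be any instance of the online matching problem with reusable resources such that for every $i\in[N]$ the usage duration distribution is $F_i=\mathrm{Geometric}(p_i)$ for some $p_i\geq 0$. Let $p=\min_{i\in[N]}p_i$. Then $$\frac{\mathsf{Greedy}(\mathcal{I})}{\mathsf{OPT}(\mathcal{I})}\ \ge\ \frac{1+p}{2}.$$
   Context: Model. An instance $\mathcal{I}=(G,\{r_i,F_i\}_{i\in[N]})$ consists of a bipartite graph $G$ with $N$ offline vertices ("resources", indexed by $[N]=\{1,\dots,N\}$) and $T$ online vertices ("requests", indexed by $1,\dots,T$), rewards $0\le r_1\le\dots\le r_N$, and for each resource $i$ a probability distribution $F_i$ of usage durations, supported on $\{1,2,3,\dots\}\cup\{+\infty\}$ ($+\infty$ meaning the resource never returns). Let $N_t\subseteq[N]$ be the set of resources adjacent to request $t$. At each time $t=1,\dots,T$ request $t$ arrives, $N_t$ is revealed, and a policy irrevocably chooses $A_t\in(N_t\cap I_t)\cup\{0\}$, where $I_t\subseteq[N]$ is the set of resources available at time $t$ (all resources are available at time 1) and $0$ means no match. If $A_t=i\in[N]$, the policy earns reward $r_i$, and resource $i$ becomes unavailable for a random duration $D_{it}\ge1$ drawn from $F_i$, independently for every match; it becomes available again at the start of time $t+D_{it}$ and can be matched immediately. $\mathrm{Geometric}(q)$, for $q\in[0,1]$, is the distribution on $\{1,2,\dots\}$ with $\Pr(D=k)=(1-q)^{k-1}q$; for $q=0$ the duration is $+\infty$ almost surely. The greedy policy chooses $A_t=\max\big((N_t\cap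 I_t)\cup\{0\}\big)$, i.e. the available adjacent resource of highest index (hence highest reward). $\mathsf{Greedy}(\mathcal{I})$ is its expected total reward. $\mathsf{OPT}(\mathcal{I})$ is the expected total reward of an optimal clairvoyant policy: a policy of maximum expected total reward among all policies that know the whole instance $\mathcal{I}$ (in particular the entire graph $G$) in advance but do not know the realizations of the usage durations ahead of time (decisions at time $t$ depend only on what has been observed so far). If $\mathsf{OPT}(\mathcal{I})=0$, the ratio inequality is read as the inequality obtained by multiplying through by $\mathsf{OPT}(\mathcal{I})$. -}

module Defs where

open import Algebra.Bundles using (CommutativeRing)
import Algebra.Properties.Semiring.Exp as Exp
import Algebra.Properties.Semiring.Sum as Sum
open import Data.Fin.Base as Fin using (Fin; zero; suc; toℕ)
open import Data.Fin.Subset using (Side; inside; outside; Subset; _∈_; _∩_)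
open import Data.Maybe.Base as Maybe using (Maybe; just; nothing)
open import Data.Nat.Base as ℕ using (ℕ; zero; suc; pred)
open import Data.Product.Base using (∃; _×_; _,_; proj₁; proj₂)
open import Data.Sum.Base using (inj₁; inj₂)
open import Data.Unit.Base using (⊤; tt)
open import Data.Vec.Base as Vec using (Vec; []; _∷_; here; there; _[_]≔_; replicate)
open import Level using (_⊔_) renaming (suc to lsuc)
open import Relation.Binary.Core using (Rel)
open import Relation.Binary.PropositionalEquality.Core as ≡ using (_≡_)
open import Relation.Binary.Structures using (IsDecTotalOrder)
open import Relation.Nullary.Negation.Core using (¬_)

-- The reals enter only through these axioms: with finitely many requests
-- every expectation below is a finite sum.  The value of 0# ⁻¹ is irrelevant.
record OrderedField c ℓ₁ ℓ₂ : Set (lsuc (c ⊔ ℓ₁ ⊔ ℓ₂)) where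
  infix 4 _≤_
  infix 9 _⁻¹
  infixl 7 _/_
  field
    commutativeRing : CommutativeRing c ℓ₁
  open CommutativeRing commutativeRing public
  field
    _≤_             : Rel Carrier ℓ₂
    _⁻¹             : Carrier → Carrier
    isDecTotalOrder : IsDecTotalOrder _≈_ _≤_
    +-monoˡ-≤       : ∀ {x y} z → x ≤ y → x + z ≤ y + z
    *-nonNegative   : ∀ {x y} → 0# ≤ x → 0# ≤ y → 0# ≤ x * y
    ⁻¹-inverseʳ     : ∀ x → ¬ (x ≈ 0#) → x * x ⁻¹ ≈ 1#
    1#≉0#           : ¬ (1# ≈ 0#)

  _/_ : Carrier → Carrier → Carrier
  x / y = x * y ⁻¹

  2# : Carrier
  2# = 1# + 1#

-- `nothing` is +∞.
ℕ∞ : Set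
ℕ∞ = Maybe ℕ

-- For every resource, the time left until it is available; 0 means available.
State : ℕ → Set
State N = Vec ℕ∞ N

allAvailable : ∀ {N} → State N
allAvailable = replicate _ (just 0)

tick : ∀ {N} → State N → State N
tick = Vec.map (Maybe.map pred)

isAvailable : ℕ∞ → Side
isAvailable (just zero)    = inside
isAvailable (just (suc _)) = outside
isAvailable nothing        = outside

available : ∀ {N} → State N → Subset N
available = Vec.map isAvailable

-- `nothing` is the action 0 (no match).
Choice : ∀ {N} → Subset N → Set
Choice S = Maybe (∃ λ i → i ∈ S)

-- A request sequence is given by the neighbourhoods N₁ , … , N_T.  A policy for
-- it is a decision tree: having observed the available set Iₜ it selects an
-- element of (Nₜ ∩ Iₜ) ∪ {0} and a policy for the later requests.  Hence Aₜ is an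
-- arbitrary function of I₁ , … , Iₜ, which determine A₁ , … , Aₜ₋₁ and with them
-- every duration that has ended so far.
Policy : ∀ {N T} → Vec (Subset N) T → Set
Policy []      = ⊤
Policy (S ∷ G) = ∀ Iₜ → Choice (S ∩ Iₜ) × Policy G

highest : ∀ {N} (S : Subset N) → Choice S
highest []      = nothing
highest (s ∷ S) with highest S
highest (s       ∷ S) | just (i , i∈S) = just (suc i , there i∈S)
highest (inside  ∷ S) | nothing        = just (zero , here)
highest (outside ∷ S) | nothing        = nothing

greedy : ∀ {N T} (G : Vec (Subset N) T) → Policy G
greedy []      = tt
greedy (S ∷ G) = λ Iₜ → highest (S ∩ Iₜ) , greedy G

module Matching {c ℓ₁ ℓ₂} (K : OrderedField c ℓ₁ ℓ₂) where

  open OrderedField K hiding (zero)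
  open Exp semiring using (_^_)
  open Sum semiring using (sum; sum-cong-≋)

  -- A distribution on {1,2,…} ∪ {+∞}: pmf k is the probability of 1 + k, and the
  -- mass not exhausted by the finite durations sits at +∞.
  record Distribution : Set (c ⊔ ℓ₂) where
    field
      pmf        : ℕ → Carrier
      pmf-nonNeg : ∀ k → 0# ≤ pmf k
      pmf-sum≤1  : ∀ n → sum {n} (λ k → pmf (toℕ k)) ≤ 1#

  open Distribution

  record IsGeometric (F : Distribution) (q : Carrier) : Set (ℓ₁ ⊔ ℓ₂) where
    field
      0≤q  : 0# ≤ q
      q≤1  : q ≤ 1#
      pmf≈ : ∀ k → pmf F k ≈ (1# - q) ^ k * q

  -- E[g(D)] for D ∼ F, where g takes the value g(+∞) at every duration > n, so
  -- that these durations can be lumped together with probability P(D > n).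
  expectation : Distribution → ℕ → (ℕ∞ → Carrier) → Carrier
  expectation F n g =
    sum {n} (λ k → pmf F (toℕ k) * g (just (suc (toℕ k))))
    + (1# - sum {n} (λ k → pmf F (toℕ k))) * g nothing

  record Instance (N T : ℕ) : Set (c ⊔ ℓ₂) where
    field
      G        : Vec (Subset N) T
      r        : Fin N → Carrier
      F        : Fin N → Distribution
      r-nonNeg : ∀ i → 0# ≤ r i
      r-mono   : ∀ {i j} → i Fin.≤ j → r i ≤ r j

  module _ {N : ℕ} (r : Fin N → Carrier) (F : Fin N → Distribution) where

    -- Expected total reward from the current request on.  The state holds the
    -- durations already drawn; the policy sees only which resources are
    -- available.  With n requests still to come after the present one, a
    -- duration > n acts like +∞.
    rewardFrom : ∀ {T} (G : Vec (Subset N) T) → Policy G → State N → Carrier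
    rewardFrom []            π s = 0#
    rewardFrom (_∷_ {n} S G) π s with π (available s)
    ... | nothing      , π′ = rewardFrom G π′ (tick s)
    ... | just (i , _) , π′ =
      r i + expectation (F i) n (λ d → rewardFrom G π′ (tick (s [ i ]≔ d)))

  reward : ∀ {N T} (I : Instance N T) → Policy (Instance.G I) → Carrier
  reward I π = rewardFrom r F G π allAvailable
    where open Instance I

  Greedy : ∀ {N T} → Instance N T → Carrier
  Greedy I = reward I (greedy (Instance.G I))

  private
    module ≤ = IsDecTotalOrder isDecTotalOrder

    Argmax : (X : Set) → (X → X → Set) → Set (c ⊔ ℓ₂)
    Argmax X _~_ = (f : X → Carrier) → (∀ {x y} → x ~ y → f x ≤ f y) →
                   ∃ λ x → ∀ y → f y ≤ f x

    argmax-choice : ∀ {N} (S : Subset N) → Argmax (Choice S) _≡_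
    argmax-choice {N} S f _ = go S f
      where
      lift : ∀ {N s} {S : Subset N} → Choice S → Choice (s ∷ S)
      lift = Maybe.map λ (i , i∈S) → suc i , there i∈S

      go : ∀ {N} (S : Subset N) (f : Choice S → Carrier) → ∃ λ x → ∀ y → f y ≤ f x
      go [] f = nothing , λ where
        nothing         → ≤.refl
        (just (() , _))
      go (outside ∷ S) f with go S (λ x → f (lift x))
      ... | x , max = lift x , λ where
        nothing                    → max nothing
        (just (suc i , there i∈S)) → max (just (i , i∈S))
      go (inside ∷ S) f with go S (λ x → f (lift x))
      ... | x , max with ≤.total (f (lift x)) (f (just (zero , here)))
      ... | inj₁ le = just (zero , here) , λ where
        nothing                    → ≤.trans (max nothing) le
        (just (zero , here))       → ≤.refl
        (just (suc i , there i∈S)) → ≤.trans (max (just (i , i∈S))) le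
      ... | inj₂ ge = lift x , λ where
        nothing                    → max nothing
        (just (zero , here))       → ge
        (just (suc i , there i∈S)) → max (just (i , i∈S))

    argmax-× : ∀ {X Y} {_~_ : X → X → Set} {_≃_ : Y → Y → Set} →
               (∀ {x} → x ~ x) → (∀ {y} → y ≃ y) → Argmax X _~_ → Argmax Y _≃_ →
               Argmax (X × Y) (λ u v → (proj₁ u ~ proj₁ v) × (proj₂ u ≃ proj₂ v))
    argmax-× {X} {Y} ~-refl ≃-refl argmaxX argmaxY f resp = (x* , y* x*) , max
      where
      best : ∀ x → ∃ λ y → ∀ y′ → f (x , y′) ≤ f (x , y)
      best x = argmaxY (λ y → f (x , y)) (λ e → resp (~-refl , e))
      y* : X → Y
      y* x = proj₁ (best x)
      outer : ∃ λ x → ∀ x′ → f (x′ , y* x′) ≤ f (x , y* x)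
      outer = argmaxX (λ x → f (x , y* x))
                (λ {x} {x′} e → ≤.trans (resp (e , ≃-refl)) (proj₂ (best x′) (y* x)))
      x* : X
      x* = proj₁ outer
      max : ∀ u → f u ≤ f (x* , y* x*)
      max (x , y) = ≤.trans (proj₂ (best x) y) (proj₂ outer x)

    argmax-Π : ∀ {N} {X : Subset N → Set} {_~_ : ∀ {A} → X A → X A → Set} →
               (∀ {A} {x : X A} → x ~ x) → (∀ A → Argmax (X A) _~_) →
               Argmax (∀ A → X A) (λ g h → ∀ A → g A ~ h A)
    argmax-Π {zero} {X} ~-refl argmaxX f resp
      with argmaxX [] (λ x → f (at[] x)) (λ e → resp λ { [] → e })
      where
      at[] : X [] → ∀ A → X A
      at[] x [] = x
    ... | x , max = _ ,
      λ g → ≤.trans (resp λ { [] → ~-refl }) (max (g []))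
    argmax-Π {suc N} {X} {_~_} ~-refl argmaxX f resp
      with argmax-× (λ A → ~-refl) (λ A → ~-refl)
             (argmax-Π {X = λ A → X (inside ∷ A)} {_~_ = _~_} ~-refl (λ A → argmaxX (inside ∷ A)))
             (argmax-Π {X = λ A → X (outside ∷ A)} {_~_ = _~_} ~-refl (λ A → argmaxX (outside ∷ A)))
             (λ u → f (join u))
             (λ (e , e′) → resp λ { (inside ∷ A) → e A ; (outside ∷ A) → e′ A })
      where
      join : (∀ A → X (inside ∷ A)) × (∀ A → X (outside ∷ A)) → ∀ A → X A
      join (g , h) (inside  ∷ A) = g A
      join (g , h) (outside ∷ A) = h A
    ... | (g , h) , max = _ , λ k →
      ≤.trans (resp λ { (inside ∷ A) → ~-refl ; (outside ∷ A) → ~-refl })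
              (max ((λ A → k (inside ∷ A)) , (λ A → k (outside ∷ A))))

    expectation-cong : ∀ F n {g h : ℕ∞ → Carrier} → (∀ d → g d ≈ h d) →
                       expectation F n g ≈ expectation F n h
    expectation-cong F n g≈h =
      +-cong (sum-cong-≋ {n} λ k → *-congˡ (g≈h (just (suc (toℕ k)))))
             (*-congˡ (g≈h nothing))

    module _ {N : ℕ} where

      _≐_ : ∀ {T} {G : Vec (Subset N) T} → Policy G → Policy G → Set
      _≐_ {G = []}    _ _  = ⊤
      _≐_ {G = S ∷ G} π π′ =
        ∀ A → (proj₁ (π A) ≡ proj₁ (π′ A)) × (_≐_ {G = G} (proj₂ (π A)) (proj₂ (π′ A)))

      ≐-refl : ∀ {T} (G : Vec (Subset N) T) {π : Policy G} → _≐_ {G = G} π π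
      ≐-refl []      = tt
      ≐-refl (S ∷ G) = λ A → ≡.refl , ≐-refl G

      argmax-policy : ∀ {T} (G : Vec (Subset N) T) → Argmax (Policy G) (_≐_ {G = G})
      argmax-policy []      f resp = tt , λ _ → ≤.refl
      argmax-policy (S ∷ G) =
        argmax-Π (≡.refl , ≐-refl G) λ A →
          argmax-× ≡.refl (≐-refl G) (argmax-choice (S ∩ A)) (argmax-policy G)

      rewardFrom-cong : ∀ r F {T} (G : Vec (Subset N) T) {π π′ : Policy G} →
                        _≐_ {G = G} π π′ →
                        ∀ s → rewardFrom r F G π s ≈ rewardFrom r F G π′ s
      rewardFrom-cong r F []      e s = refl
      rewardFrom-cong r F (_∷_ {n} S G) {π} {π′} e s
        with π (available s) | π′ (available s) | e (available s)
      ... | nothing      , _ | _ | ≡.refl , e′ = rewardFrom-cong r F G e′ (tick s)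
      ... | just (i , _) , _ | _ | ≡.refl , e′ =
        +-congˡ (expectation-cong (F i) n λ d →
          rewardFrom-cong r F G e′ (tick (s [ i ]≔ d)))

  optimal : ∀ {N T} (I : Instance N T) → ∃ λ π* → ∀ π → reward I π ≤ reward I π*
  optimal I = argmax-policy (Instance.G I) (reward I)
    λ e → ≤.reflexive (rewardFrom-cong r F G e allAvailable)
    where open Instance I

  OPT : ∀ {N T} → Instance N T → Carrier
  OPT I = reward I (proj₁ (optimal I))

  IsMinimum : ∀ {N} → (Fin N → Carrier) → Carrier → Set (ℓ₁ ⊔ ℓ₂)
  IsMinimum f m = (∃ λ i → m ≈ f i) × (∀ i → m ≤ f i)

{-# OPTIONS --safe #-}
module Submission where

-- Geometric durations are memoryless, so a policy acts on a Markov chain whose state is the set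
-- of available resources: after each match, every absent resource i returns with probability pᵢ.
-- Run greedy and an arbitrary policy π with the same returns, and let A and B be the sets left to
-- them after a match, before the next returns.  By induction on the remaining requests,
--     (1 + p) · value π B ≤ 2 · value greedy A + (1 − p) · Σ_{i ∈ B ∖ A} rᵢ.
-- If π's next choice o is available to greedy, then greedy earns at least r_o.  Otherwise o lies in
-- B ∖ A and has not returned to greedy; as π's choice is independent of that return, one may
-- average over it.  If greedy would use o upon return, the gain 2(1 − p) r_o, made with probability
-- p_o ≥ p, pays for the loss 2p r_o made otherwise; if it would not, it uses something better anyway.

open import Defs
import Algebra.Properties.Ring as RingProperties
import Algebra.Properties.Semiring.Exp as Exp
import Algebra.Properties.Semiring.Sum as Sum
import Algebra.Solver.Ring.NaturalCoefficients.Default as SemiringSolver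
open import Data.Empty using (⊥-elim)
open import Data.Fin.Base as Fin using (Fin; zero; suc; toℕ)
import Data.Fin.Properties as Finₚ
open import Data.Fin.Subset using (inside; outside; Subset; _∈_; _∉_; _∩_; _∪_) renaming (⊤ to full)
open import Data.Fin.Subset.Properties using (_∈?_; x∈p∩q⁺; x∈p∩q⁻; x∈p∪q⁺; x∈p∪q⁻)
open import Data.Maybe.Base as Maybe using (Maybe; just; nothing)
open import Data.Nat.Base using (ℕ; zero; suc; pred; z≤n; s≤s)
open import Data.Product.Base using (∃; _×_; _,_; proj₁; proj₂)
open import Data.Sum.Base using (inj₁; inj₂)
open import Data.Vec.Base as Vec using (Vec; []; _∷_; here; there; _[_]≔_)
open import Data.Vec.Properties using ([]≔-updates; []≔-minimal; []≔-idempotent)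
open import Function.Base using (_∘_)
open import Relation.Binary.Bundles using (Poset)
open import Relation.Binary.PropositionalEquality.Core as ≡ using (_≡_)
import Relation.Binary.Reasoning.PartialOrder as ≤-Reasoning
import Relation.Binary.Reasoning.Setoid as ≈-Reasoning
open import Relation.Binary.Structures using (IsDecTotalOrder)
open import Relation.Nullary.Decidable.Core using (yes; no)
open import Relation.Nullary.Negation.Core using (¬_)

-- Order arithmetic in an ordered field.

module OrderedFieldProperties {c ℓ₁ ℓ₂} (K : OrderedField c ℓ₁ ℓ₂) where

  open OrderedField K hiding (zero)
  open IsDecTotalOrder isDecTotalOrder public
    using (isPartialOrder; total; antisym; ≤-respˡ-≈; ≤-respʳ-≈)
    renaming (refl to ≤-refl; reflexive to ≤-reflexive; trans to ≤-trans)
  open RingProperties ring using (-‿distribˡ-*; -‿involutive)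

  poset : Poset _ _ _
  poset = record { isPartialOrder = isPartialOrder }

  +-monoʳ-≤ : ∀ {x y} z → x ≤ y → z + x ≤ z + y
  +-monoʳ-≤ z x≤y = ≤-respˡ-≈ (+-comm _ z) (≤-respʳ-≈ (+-comm _ z) (+-monoˡ-≤ z x≤y))

  +-mono-≤ : ∀ {x y u v} → x ≤ y → u ≤ v → x + u ≤ y + v
  +-mono-≤ x≤y u≤v = ≤-trans (+-monoˡ-≤ _ x≤y) (+-monoʳ-≤ _ u≤v)

  x≤y⇒0≤y-x : ∀ {x y} → x ≤ y → 0# ≤ y - x
  x≤y⇒0≤y-x {x} x≤y = ≤-respˡ-≈ (-‿inverseʳ x) (+-monoˡ-≤ (- x) x≤y)

  x+[y-x]≈y : ∀ x y → x + (y - x) ≈ y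
  x+[y-x]≈y x y = begin
    x + (y - x)    ≈⟨ +-congˡ (+-comm y (- x)) ⟩
    x + (- x + y)  ≈⟨ +-assoc x (- x) y ⟨
    (x - x) + y    ≈⟨ +-congʳ (-‿inverseʳ x) ⟩
    0# + y         ≈⟨ +-identityˡ y ⟩
    y              ∎
    where open ≈-Reasoning setoid

  x≤y+x : ∀ {x y} → 0# ≤ y → x ≤ y + x
  x≤y+x {x} 0≤y = ≤-respˡ-≈ (+-identityˡ x) (+-monoˡ-≤ x 0≤y)

  *-monoʳ-≤ : ∀ {x y z} → 0# ≤ z → x ≤ y → z * x ≤ z * y
  *-monoʳ-≤ {x} {y} {z} 0≤z x≤y = begin
    z * x                ≤⟨ x≤y+x (*-nonNegative 0≤z (x≤y⇒0≤y-x x≤y)) ⟩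
    z * (y - x) + z * x  ≈⟨ distribˡ z (y - x) x ⟨
    z * (y - x + x)      ≈⟨ *-congˡ (trans (+-comm (y - x) x) (x+[y-x]≈y x y)) ⟩
    z * y                ∎
    where open ≤-Reasoning poset

  *-monoˡ-≤ : ∀ {x y z} → 0# ≤ z → x ≤ y → x * z ≤ y * z
  *-monoˡ-≤ 0≤z x≤y = ≤-respˡ-≈ (*-comm _ _) (≤-respʳ-≈ (*-comm _ _) (*-monoʳ-≤ 0≤z x≤y))

  0≤1 : 0# ≤ 1#
  0≤1 with total 0# 1#
  ... | inj₁ 0≤1 = 0≤1
  -- If 1 ≤ 0, then -1 is nonnegative, and so is its square, which is 1.
  ... | inj₂ 1≤0 = ≤-respʳ-≈ [-1]²≈1 (*-nonNegative 0≤-1 0≤-1)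
    where
    0≤-1 : 0# ≤ - 1#
    0≤-1 = ≤-respʳ-≈ (+-identityˡ _) (x≤y⇒0≤y-x 1≤0)
    [-1]²≈1 : (- 1#) * (- 1#) ≈ 1#
    [-1]²≈1 = begin
      (- 1#) * (- 1#)  ≈⟨ -‿distribˡ-* 1# (- 1#) ⟨
      - (1# * - 1#)    ≈⟨ -‿cong (*-identityˡ _) ⟩
      - - 1#           ≈⟨ -‿involutive 1# ⟩
      1#               ∎
      where open ≈-Reasoning setoid

  0≤2 : 0# ≤ 2#
  0≤2 = ≤-trans 0≤1 (x≤y+x 0≤1)

  2≉0 : ¬ (2# ≈ 0#)
  2≉0 2≈0 = 1#≉0# (antisym (≤-respʳ-≈ 2≈0 (x≤y+x 0≤1)) 0≤1)

  2*[x/2]≈x : ∀ x → 2# * (x / 2#) ≈ x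
  2*[x/2]≈x x = begin
    2# * (x * 2# ⁻¹)  ≈⟨ *-congˡ (*-comm x _) ⟩
    2# * (2# ⁻¹ * x)  ≈⟨ *-assoc 2# _ x ⟨
    (2# * 2# ⁻¹) * x  ≈⟨ *-congʳ (⁻¹-inverseʳ 2# 2≉0) ⟩
    1# * x            ≈⟨ *-identityˡ x ⟩
    x                 ∎
    where open ≈-Reasoning setoid

  2*-cancel-≤ : ∀ {x y} → 2# * x ≤ 2# * y → x ≤ y
  2*-cancel-≤ {x} {y} 2x≤2y with total x y
  ... | inj₁ x≤y = x≤y
  -- Here both doubles are equal by antisymmetry, and halving gives equality; the sign of `2# ⁻¹`
  -- never enters.
  ... | inj₂ y≤x = ≤-reflexive (begin
      x                ≈⟨ halve x ⟨
      (2# * x) / 2#    ≈⟨ *-congʳ (antisym 2x≤2y (*-monoʳ-≤ 0≤2 y≤x)) ⟩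
      (2# * y) / 2#    ≈⟨ halve y ⟩
      y                ∎)
    where
    open ≈-Reasoning setoid
    halve : ∀ z → (2# * z) / 2# ≈ z
    halve z = trans (*-assoc 2# z _) (2*[x/2]≈x z)

-- Two-point mixtures.

module Mixture {c ℓ₁ ℓ₂} (K : OrderedField c ℓ₁ ℓ₂) where

  open OrderedField K hiding (zero)
  open OrderedFieldProperties K
  open SemiringSolver commutativeSemiring

  mix : Carrier → Carrier → Carrier → Carrier
  mix q x y = q * x + (1# - q) * y

  mix-cong : ∀ q {x y u v} → x ≈ y → u ≈ v → mix q x u ≈ mix q y v
  mix-cong q x≈y u≈v = +-cong (*-congˡ x≈y) (*-congˡ u≈v)

  mix-mono : ∀ {q x y u v} → 0# ≤ q → q ≤ 1# → x ≤ y → u ≤ v → mix q x u ≤ mix q y v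
  mix-mono 0≤q q≤1 x≤y u≤v =
    +-mono-≤ (*-monoʳ-≤ 0≤q x≤y) (*-monoʳ-≤ (x≤y⇒0≤y-x q≤1) u≤v)

  mix-affine : ∀ q a x y k → mix q (a * x + k) (a * y + k) ≈ a * mix q x y + k
  mix-affine q a x y k = begin
    mix q (a * x + k) (a * y + k)
      -- The semiring solver has no subtraction: `1# - q` enters as an independent variable q′, and
      -- q + q′ = 1 is applied afterwards.
      ≈⟨ solve 6 (λ q q′ a x y k → q :* (a :* x :+ k) :+ q′ :* (a :* y :+ k)
                                   := a :* (q :* x :+ q′ :* y) :+ (q :+ q′) :* k)
           refl q (1# - q) a x y k ⟩
    a * mix q x y + (q + (1# - q)) * k
      ≈⟨ +-congˡ (trans (*-congʳ (x+[y-x]≈y q 1#)) (*-identityˡ k)) ⟩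
    a * mix q x y + k ∎
    where open ≈-Reasoning setoid

  mix-const : ∀ q x → mix q x x ≈ x
  mix-const q x = begin
    mix q x x           ≈⟨ distribʳ x q (1# - q) ⟨
    (q + (1# - q)) * x  ≈⟨ *-congʳ (x+[y-x]≈y q 1#) ⟩
    1# * x              ≈⟨ *-identityˡ x ⟩
    x                   ∎
    where open ≈-Reasoning setoid

  mix-+ : ∀ q k x y → mix q (k + x) (k + y) ≈ k + mix q x y
  mix-+ q k x y = begin
    mix q (k + x) (k + y)
      ≈⟨ solve 5 (λ q q′ k x y → q :* (k :+ x) :+ q′ :* (k :+ y)
                                 := (q :* k :+ q′ :* k) :+ (q :* x :+ q′ :* y))
           refl q (1# - q) k x y ⟩
    mix q k k + mix q x y
      ≈⟨ +-congʳ (mix-const q k) ⟩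
    k + mix q x y ∎
    where open ≈-Reasoning setoid

  -- Fubini for two independent coins, the seed of every interchange of expectations below.
  mix-comm : ∀ q a x y u v → mix q (mix a x y) (mix a u v) ≈ mix a (mix q x u) (mix q y v)
  mix-comm q a x y u v =
    solve 8 (λ q q′ a a′ x y u v →
               q :* (a :* x :+ a′ :* y) :+ q′ :* (a :* u :+ a′ :* v)
               := a :* (q :* x :+ q′ :* u) :+ a′ :* (q :* y :+ q′ :* v))
      refl q (1# - q) a (1# - a) x y u v

-- Truncated geometric durations and memorylessness.

module Durations {c ℓ₁ ℓ₂} (K : OrderedField c ℓ₁ ℓ₂) where

  open OrderedField K hiding (zero)
  open OrderedFieldProperties K
  open Mixture K
  open Matching K
  open Exp semiring using (_^_)
  open Sum semiring using (sum; sum-cong-≋; *-distribˡ-sum)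

  -- E[g(D)] for a geometric D, in the recursive form that memorylessness suggests: D is 1 with
  -- probability q, and otherwise 1 plus a fresh copy. Durations beyond the horizon n are read as
  -- +∞.
  geometric : Carrier → ℕ → (ℕ∞ → Carrier) → Carrier
  geometric q zero    g = g nothing
  geometric q (suc n) g = mix q (g (just 1)) (geometric q n (g ∘ Maybe.map suc))

  geometric-cong : ∀ q n {g h : ℕ∞ → Carrier} →
    (∀ k → g (just (suc k)) ≈ h (just (suc k))) → g nothing ≈ h nothing →
    geometric q n g ≈ geometric q n h
  geometric-cong q zero    fin inf = inf
  geometric-cong q (suc n) fin inf = mix-cong q (fin 0) (geometric-cong q n (fin ∘ suc) inf)

  geometric-const : ∀ q n x → geometric q n (λ _ → x) ≈ x
  geometric-const q zero    x = refl
  geometric-const q (suc n) x = trans (mix-cong q refl (geometric-const q n x)) (mix-const q x)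

  geometric-+ : ∀ q n k (g : ℕ∞ → Carrier) →
    geometric q n (λ d → k + g d) ≈ k + geometric q n g
  geometric-+ q zero    k g = refl
  geometric-+ q (suc n) k g =
    trans (mix-cong q refl (geometric-+ q n k (g ∘ Maybe.map suc))) (mix-+ q k _ _)

  geometric-mix : ∀ q n a (g h : ℕ∞ → Carrier) →
    geometric q n (λ d → mix a (g d) (h d)) ≈ mix a (geometric q n g) (geometric q n h)
  geometric-mix q zero    a g h = refl
  geometric-mix q (suc n) a g h =
    trans (mix-cong q refl (geometric-mix q n a (g ∘ Maybe.map suc) (h ∘ Maybe.map suc)))
          (mix-comm q a _ _ _ _)

  -- Fubini for two independent durations: the first is unrolled one period at a time, and each
  -- mixture moves through the second.
  geometric-comm : ∀ q m q′ n (g : ℕ∞ → ℕ∞ → Carrier) →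
    geometric q m (λ d → geometric q′ n (g d))
    ≈ geometric q′ n (λ e → geometric q m (λ d → g d e))
  geometric-comm q zero    q′ n g = refl
  geometric-comm q (suc m) q′ n g =
    trans (mix-cong q refl (geometric-comm q m q′ n (g ∘ Maybe.map suc)))
          (sym (geometric-mix q′ n q _ _))

  -- Memorylessness: after one period the duration has ended with probability q, and otherwise the
  -- time left is again geometric, with a horizon shorter by one.
  geometric-pred : ∀ q n (g : ℕ∞ → Carrier) →
    geometric q (suc n) (g ∘ Maybe.map pred) ≈ mix q (g (just 0)) (geometric q n g)
  geometric-pred q n g = mix-cong q refl (geometric-cong q n (λ _ → refl) refl)

  module _ (q : Carrier) where

    private
      mass : ℕ → Carrier
      mass k = (1# - q) ^ k * q

      tail : ∀ n (g : ℕ → Carrier) →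
        sum {n} (λ k → mass (suc (toℕ k)) * g (toℕ k))
        ≈ (1# - q) * sum {n} (λ k → mass (toℕ k) * g (toℕ k))
      tail n g = trans
        (sum-cong-≋ {n} λ k → trans (*-congʳ (*-assoc _ _ q)) (*-assoc _ _ _))
        (sym (*-distribˡ-sum {n} (1# - q) _))

    -- The left side is `expectation` with the geometric masses inserted. Splitting off duration 1
    -- leaves 1 - q times the same masses shifted by one, and the mass left for +∞ acquires the same
    -- factor (`rest`).
    geometric-sum : ∀ n (g : ℕ∞ → Carrier) →
      sum {n} (λ k → mass (toℕ k) * g (just (suc (toℕ k))))
        + (1# - sum {n} (λ k → mass (toℕ k))) * g nothing
      ≈ geometric q n g
    geometric-sum zero g = begin
      0# + (1# - 0#) * g nothing  ≈⟨ +-identityˡ _ ⟩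
      (1# - 0#) * g nothing       ≈⟨ *-congʳ (trans (sym (+-identityˡ _)) (x+[y-x]≈y 0# 1#)) ⟩
      1# * g nothing              ≈⟨ *-identityˡ _ ⟩
      g nothing                   ∎
      where open ≈-Reasoning setoid
    geometric-sum (suc n) g = begin
      (1# * q * g (just 1) + X′) + (1# - (1# * q + Y′)) * z
        ≈⟨ +-cong (+-cong (*-congʳ (*-identityˡ q)) (tail n (λ k → g (just (suc (suc k))))))
                  (*-congʳ rest) ⟩
      (q * g (just 1) + (1# - q) * X) + ((1# - q) * (1# - Y)) * z
        ≈⟨ +-assoc _ _ _ ⟩
      q * g (just 1) + ((1# - q) * X + ((1# - q) * (1# - Y)) * z)
        ≈⟨ +-congˡ (+-congˡ (*-assoc _ _ _)) ⟩
      q * g (just 1) + ((1# - q) * X + (1# - q) * ((1# - Y) * z))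
        ≈⟨ +-congˡ (distribˡ _ _ _) ⟨
      q * g (just 1) + (1# - q) * (X + (1# - Y) * z)
        ≈⟨ mix-cong q refl (geometric-sum n (g ∘ Maybe.map suc)) ⟩
      mix q (g (just 1)) (geometric q n (g ∘ Maybe.map suc)) ∎
      where
      open ≈-Reasoning setoid
      open RingProperties ring using (-‿distribʳ-*; -‿+-comm)
      z  = g nothing
      X  = sum {n} (λ k → mass (toℕ k) * g (just (suc (suc (toℕ k)))))
      X′ = sum {n} (λ k → mass (suc (toℕ k)) * g (just (suc (suc (toℕ k)))))
      Y  = sum {n} (λ k → mass (toℕ k))
      Y′ = sum {n} (λ k → mass (suc (toℕ k)))

      Y′≈ : Y′ ≈ (1# - q) * Y
      Y′≈ = trans (sum-cong-≋ {n} λ k → *-assoc _ _ q) (sym (*-distribˡ-sum {n} (1# - q) _))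

      rest : 1# - (1# * q + Y′) ≈ (1# - q) * (1# - Y)
      rest = begin
        1# - (1# * q + Y′)               ≈⟨ +-congˡ (-‿cong (+-cong (*-identityˡ q) Y′≈)) ⟩
        1# - (q + (1# - q) * Y)          ≈⟨ +-congˡ (-‿+-comm q _) ⟨
        1# + (- q + - ((1# - q) * Y))    ≈⟨ +-assoc _ _ _ ⟨
        (1# - q) - (1# - q) * Y          ≈⟨ +-cong (sym (*-identityʳ _)) (-‿distribʳ-* _ _) ⟩
        (1# - q) * 1# + (1# - q) * - Y   ≈⟨ distribˡ _ _ _ ⟨
        (1# - q) * (1# - Y)              ∎

    expectation≈geometric : ∀ {F} → IsGeometric F q → ∀ n g → expectation F n g ≈ geometric q n g
    expectation≈geometric geo n g = trans
      (+-cong (sum-cong-≋ {n} λ k → *-congʳ (pmf≈ (toℕ k)))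
              (*-congʳ (+-congˡ (-‿cong (sum-cong-≋ {n} λ k → pmf≈ (toℕ k))))))
      (geometric-sum n g)
      where open IsGeometric geo

-- Reduction to a Markov chain on sets of resources.

module Markov {c ℓ₁ ℓ₂} (K : OrderedField c ℓ₁ ℓ₂) where

  open OrderedField K hiding (zero)
  open Mixture K
  open Durations K
  open Matching K

  -- E[f(R)] for a random set R that contains each i independently with probability q i.
  average : ∀ {N} → (Fin N → Carrier) → (Subset N → Carrier) → Carrier
  average {zero}  q f = f []
  average {suc N} q f = mix (q zero) (average (q ∘ suc) (f ∘ (inside ∷_)))
                                     (average (q ∘ suc) (f ∘ (outside ∷_)))

  average-cong : ∀ {N} (q : Fin N → Carrier) {f g : Subset N → Carrier} →
    (∀ R → f R ≈ g R) → average q f ≈ average q g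
  average-cong {zero}  q f≈g = f≈g []
  average-cong {suc N} q f≈g = mix-cong (q zero) (average-cong (q ∘ suc) (f≈g ∘ (inside ∷_)))
                                                 (average-cong (q ∘ suc) (f≈g ∘ (outside ∷_)))

  average-affine : ∀ {N} (q : Fin N → Carrier) a k (f : Subset N → Carrier) →
    average q (λ R → a * f R + k) ≈ a * average q f + k
  average-affine {zero}  q a k f = refl
  average-affine {suc N} q a k f = trans
    (mix-cong (q zero) (average-affine (q ∘ suc) a k _) (average-affine (q ∘ suc) a k _))
    (mix-affine (q zero) a _ _ k)

  -- E[f(s)] for a random state s in which the resources of A are available and the
  -- others return after independent geometric durations, cut off at n.
  averageState : ∀ {N} → (Fin N → Carrier) → ℕ → Subset N → (State N → Carrier) → Carrier
  averageState q n []            f = f []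
  averageState q n (inside  ∷ A) f = averageState (q ∘ suc) n A (λ s → f (just 0 ∷ s))
  averageState q n (outside ∷ A) f =
    averageState (q ∘ suc) n A (λ s → geometric (q zero) n (λ d → f (d ∷ s)))

  -- Resources of A carry `just 0` and the durations drawn for the others are at least 1, so only
  -- states with available set A occur. A policy therefore makes the same choice throughout the
  -- average.
  averageState-cong : ∀ {N} (q : Fin N → Carrier) n A {f g : State N → Carrier} →
    (∀ s → available s ≡ A → f s ≈ g s) → averageState q n A f ≈ averageState q n A g
  averageState-cong q n []            f≈g = f≈g [] ≡.refl
  averageState-cong q n (inside  ∷ A) f≈g =
    averageState-cong (q ∘ suc) n A λ s e → f≈g (just 0 ∷ s) (≡.cong (inside ∷_) e)
  averageState-cong q n (outside ∷ A) f≈g =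
    averageState-cong (q ∘ suc) n A λ s e → geometric-cong (q zero) n
      (λ k → f≈g (just (suc k) ∷ s) (≡.cong (outside ∷_) e))
      (f≈g (nothing ∷ s) (≡.cong (outside ∷_) e))

  averageState-const : ∀ {N} (q : Fin N → Carrier) n A x → averageState q n A (λ _ → x) ≈ x
  averageState-const q n []            x = refl
  averageState-const q n (inside  ∷ A) x = averageState-const (q ∘ suc) n A x
  averageState-const q n (outside ∷ A) x = trans
    (averageState-cong (q ∘ suc) n A λ _ _ → geometric-const (q zero) n x)
    (averageState-const (q ∘ suc) n A x)

  averageState-+ : ∀ {N} (q : Fin N → Carrier) n A k (f : State N → Carrier) →
    averageState q n A (λ s → k + f s) ≈ k + averageState q n A f
  averageState-+ q n []            k f = refl
  averageState-+ q n (inside  ∷ A) k f = averageState-+ (q ∘ suc) n A k _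
  averageState-+ q n (outside ∷ A) k f = trans
    (averageState-cong (q ∘ suc) n A λ s _ → geometric-+ (q zero) n k _)
    (averageState-+ (q ∘ suc) n A k _)

  averageState-mix : ∀ {N} (q : Fin N → Carrier) n A a (f g : State N → Carrier) →
    averageState q n A (λ s → mix a (f s) (g s))
    ≈ mix a (averageState q n A f) (averageState q n A g)
  averageState-mix q n []            a f g = refl
  averageState-mix q n (inside  ∷ A) a f g = averageState-mix (q ∘ suc) n A a _ _
  averageState-mix q n (outside ∷ A) a f g = trans
    (averageState-cong (q ∘ suc) n A λ s _ → geometric-mix (q zero) n a _ _)
    (averageState-mix (q ∘ suc) n A a _ _)

  -- Memorylessness in every coordinate: after a tick each absent resource either has returned,
  -- which puts it into R, or has a fresh geometric time left.
  averageState-tick : ∀ {N} (q : Fin N → Carrier) n A (f : State N → Carrier) →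
    averageState q (suc n) A (f ∘ tick) ≈ average q (λ R → averageState q n (A ∪ R) f)
  averageState-tick q n []            f = refl
  averageState-tick q n (inside  ∷ A) f = begin
    averageState (q ∘ suc) (suc n) A (λ s → f (just 0 ∷ tick s))
      ≈⟨ averageState-tick (q ∘ suc) n A (λ s → f (just 0 ∷ s)) ⟩
    average (q ∘ suc) (λ R → averageState (q ∘ suc) n (A ∪ R) (λ s → f (just 0 ∷ s)))
      -- The coin of a resource already in A does not change `A ∪ R`, so both of its outcomes agree.
      ≈⟨ mix-const (q zero) _ ⟨
    average q (λ R → averageState q n ((inside ∷ A) ∪ R) f) ∎
    where open ≈-Reasoning setoid
  averageState-tick q n (outside ∷ A) f = begin
    averageState (q ∘ suc) (suc n) A (λ s → geometric (q zero) (suc n) (λ d → f (tick (d ∷ s))))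
      ≈⟨ averageState-cong (q ∘ suc) (suc n) A
           (λ s _ → geometric-pred (q zero) n (λ d → f (d ∷ tick s))) ⟩
    averageState (q ∘ suc) (suc n) A
      (λ s → mix (q zero) (f (just 0 ∷ tick s)) (geometric (q zero) n (λ d → f (d ∷ tick s))))
      ≈⟨ averageState-mix (q ∘ suc) (suc n) A (q zero) _ _ ⟩
    mix (q zero)
      (averageState (q ∘ suc) (suc n) A (λ s → f (just 0 ∷ tick s)))
      (averageState (q ∘ suc) (suc n) A (λ s → geometric (q zero) n (λ d → f (d ∷ tick s))))
      ≈⟨ mix-cong (q zero)
           (averageState-tick (q ∘ suc) n A (λ s → f (just 0 ∷ s)))
           (averageState-tick (q ∘ suc) n A (λ s → geometric (q zero) n (λ d → f (d ∷ s)))) ⟩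
    average q (λ R → averageState q n ((outside ∷ A) ∪ R) f) ∎
    where open ≈-Reasoning setoid

  -- A newly drawn duration is distributed like that of an absent resource. It is drawn after all
  -- others, and Fubini moves it past the absent resources that precede i.
  averageState-match : ∀ {N} (q : Fin N → Carrier) n {A} {i} → i ∈ A → ∀ (f : State N → Carrier) →
    averageState q n A (λ s → geometric (q i) n (λ d → f (s [ i ]≔ d)))
    ≈ averageState q n (A [ i ]≔ outside) f
  averageState-match q n {inside  ∷ A} here        f = refl
  averageState-match q n {inside  ∷ A} (there i∈A) f = averageState-match (q ∘ suc) n i∈A _
  averageState-match q n {outside ∷ A} (there i∈A) f = trans
    (averageState-cong (q ∘ suc) n A λ s _ → geometric-comm (q zero) n _ n _)
    (averageState-match (q ∘ suc) n i∈A _)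

  averageState-full : ∀ {N} (q : Fin N → Carrier) n (f : State N → Carrier) →
    averageState q n full f ≈ f allAvailable
  averageState-full {zero}  q n f = refl
  averageState-full {suc N} q n f = averageState-full (q ∘ suc) n (λ s → f (just 0 ∷ s))

  tick-allAvailable : ∀ N → tick (allAvailable {N}) ≡ allAvailable
  tick-allAvailable zero    = ≡.refl
  tick-allAvailable (suc N) = ≡.cong (just 0 ∷_) (tick-allAvailable N)

  remove : ∀ {N} {S : Subset N} → Choice S → Subset N → Subset N
  remove nothing        A = A
  remove (just (i , _)) A = A [ i ]≔ outside

  module _ {N : ℕ} (r : Fin N → Carrier) where

    gain : ∀ {S : Subset N} → Choice S → Carrier
    gain nothing        = 0#
    gain (just (i , _)) = r i

    module _ (q : Fin N → Carrier) where

      -- The value of π when A is the set of resources left over after the previous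
      -- match, before the others had their chance to return.
      value : ∀ {T} (G : Vec (Subset N) T) → Policy G → Subset N → Carrier
      value []      π A = 0#
      value (S ∷ G) π A = average q λ R →
        gain (proj₁ (π (A ∪ R))) + value G (proj₂ (π (A ∪ R))) (remove (proj₁ (π (A ∪ R))) (A ∪ R))

      module _ (F : Fin N → Distribution) (geo : ∀ i → IsGeometric (F i) (q i)) where

        private
          afterMatch : ∀ {S : Subset N} → ℕ → Choice S → (State N → Carrier) → State N → Carrier
          afterMatch n nothing        f s = f s
          afterMatch n (just (i , _)) f s = geometric (q i) n (λ d → f (s [ i ]≔ d))

          -- The available set is a separate A so that the choice `π A` stays fixed while s is
          -- averaged.
          rewardFrom-∷ : ∀ {n} S (G : Vec (Subset N) n) (π : Policy (S ∷ G)) A s → available s ≡ A →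
            rewardFrom r F (S ∷ G) π s
            ≈ gain (proj₁ (π A)) + afterMatch n (proj₁ (π A)) (rewardFrom r F G (proj₂ (π A)) ∘ tick) s
          rewardFrom-∷ {n} S G π _ s ≡.refl with π (available s)
          ... | nothing      , _ = sym (+-identityˡ _)
          ... | just (i , _) , _ = +-congˡ (expectation≈geometric (q i) (geo i) n _)

          averageState-remove : ∀ {S} n A (c : Choice (S ∩ A)) f →
            averageState q n A (afterMatch n c f) ≈ averageState q n (remove c A) f
          averageState-remove n A nothing            f = refl
          averageState-remove n A (just (i , i∈S∩A)) f =
            averageState-match q n (proj₂ (x∈p∩q⁻ _ A i∈S∩A)) f

        -- The policy observes only the available set, so the remaining durations can be integrated
        -- out: the tick yields the returns R, the choice is then constant, and a match makes its
        -- resource absent.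
        averageState-reward≈value : ∀ {n} (G : Vec (Subset N) n) (π : Policy G) A →
          averageState q n A (rewardFrom r F G π ∘ tick) ≈ value G π A
        averageState-reward≈value         []      π A = averageState-const q 0 A 0#
        averageState-reward≈value {suc n} (S ∷ G) π A = trans
          (averageState-tick q n A (rewardFrom r F (S ∷ G) π))
          (average-cong q λ R → step (A ∪ R))
          where
          open ≈-Reasoning setoid
          step : ∀ A → averageState q n A (rewardFrom r F (S ∷ G) π)
                       ≈ gain (proj₁ (π A)) + value G (proj₂ (π A)) (remove (proj₁ (π A)) A)
          step A = begin
            averageState q n A (rewardFrom r F (S ∷ G) π)
              ≈⟨ averageState-cong q n A (rewardFrom-∷ S G π A) ⟩
            averageState q n A (λ s → gain c′ + afterMatch n c′ f s)
              ≈⟨ averageState-+ q n A (gain c′) _ ⟩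
            gain c′ + averageState q n A (afterMatch n c′ f)
              ≈⟨ +-congˡ (averageState-remove n A c′ f) ⟩
            gain c′ + averageState q n (remove c′ A) f
              ≈⟨ +-congˡ (averageState-reward≈value G (proj₂ (π A)) _) ⟩
            gain c′ + value G (proj₂ (π A)) (remove c′ A) ∎
            where
            c′ = proj₁ (π A)
            f  = rewardFrom r F G (proj₂ (π A)) ∘ tick

        rewardFrom≈value : ∀ {n} (G : Vec (Subset N) n) (π : Policy G) →
          rewardFrom r F G π allAvailable ≈ value G π full
        rewardFrom≈value {n} G π = begin
          rewardFrom r F G π allAvailable
            -- A tick leaves the initial state unchanged; inserting one matches the convention that
            -- `value` starts just before the returns.
            ≡⟨ ≡.cong (rewardFrom r F G π) (tick-allAvailable N) ⟨
          rewardFrom r F G π (tick allAvailable)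
            ≈⟨ averageState-full q n (rewardFrom r F G π ∘ tick) ⟨
          averageState q n full (rewardFrom r F G π ∘ tick)
            ≈⟨ averageState-reward≈value G π full ⟩
          value G π full ∎
          where open ≈-Reasoning setoid

-- Comparing averages after averaging over one coordinate.

module Averaging {c ℓ₁ ℓ₂} (K : OrderedField c ℓ₁ ℓ₂) where

  open OrderedField K hiding (zero)
  open OrderedFieldProperties K
  open Mixture K
  open Markov K

  average-mix : ∀ {N} (q : Fin N → Carrier) a (f g : Subset N → Carrier) →
    average q (λ R → mix a (f R) (g R)) ≈ mix a (average q f) (average q g)
  average-mix {zero}  q a f g = refl
  average-mix {suc N} q a f g = trans
    (mix-cong (q zero) (average-mix (q ∘ suc) a _ _) (average-mix (q ∘ suc) a _ _))
    (mix-comm (q zero) a _ _ _ _)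

  private
    -- Replaces a value x by its mixture m over the head coordinate exactly where the head is the
    -- selected coordinate.
    smooth : ∀ {N} → Maybe (Fin (suc N)) → Carrier → Carrier → Carrier
    smooth (just zero) x m = m
    smooth _           x m = x

    -- The selection left for the tail; it is empty when the head was selected, since `smooth` has
    -- then done the averaging.
    lower : ∀ {N} → Maybe (Fin (suc N)) → Maybe (Fin N)
    lower (just (suc j)) = just j
    lower _              = nothing

    lower⁻ : ∀ {N} (k : Maybe (Fin (suc N))) {j} → lower k ≡ just j → k ≡ just (suc j)
    lower⁻ (just (suc _)) ≡.refl = ≡.refl

  -- To compare two averages, the comparison may first be averaged over one coordinate
  -- κ R, which may depend on R as long as it does not depend on its own value.
  average-mono : ∀ {N} {q : Fin N → Carrier} → (∀ i → 0# ≤ q i) → (∀ i → q i ≤ 1#) →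
    ∀ {f g : Subset N → Carrier} (κ : Subset N → Maybe (Fin N)) →
    (∀ R j b → κ R ≡ just j → κ (R [ j ]≔ b) ≡ just j) →
    (∀ R → κ R ≡ nothing → f R ≤ g R) →
    (∀ R j → κ R ≡ just j →
       mix (q j) (f (R [ j ]≔ inside)) (f (R [ j ]≔ outside))
       ≤ mix (q j) (g (R [ j ]≔ inside)) (g (R [ j ]≔ outside))) →
    average q f ≤ average q g
  average-mono {zero}  0≤q q≤1 κ κ-inv f≤g f≤ʲg with κ [] in e
  ... | nothing = f≤g [] e
  average-mono {suc N} {q} 0≤q q≤1 {f} {g} κ κ-inv f≤g f≤ʲg = begin
    average q f
      ≈⟨ average-smooth f ⟨
    mix q₀ (average q′ (slice f inside)) (average q′ (slice f outside))
      ≤⟨ mix-mono (0≤q zero) (q≤1 zero) (slice-mono inside) (slice-mono outside) ⟩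
    mix q₀ (average q′ (slice g inside)) (average q′ (slice g outside))
      ≈⟨ average-smooth g ⟩
    average q g ∎
    where
    open ≤-Reasoning poset
    q₀ = q zero
    q′ = q ∘ suc

    slice : (Subset (suc N) → Carrier) → _ → Subset N → Carrier
    slice h b R = smooth (κ (b ∷ R)) (h (b ∷ R)) (mix q₀ (h (inside ∷ R)) (h (outside ∷ R)))

    -- By `κ-inv` the head is selected for both of its values or for neither: either both entries
    -- have become their common mixture, or both are untouched.
    smooth-mix : ∀ h R → mix q₀ (slice h inside R) (slice h outside R)
                         ≈ mix q₀ (h (inside ∷ R)) (h (outside ∷ R))
    smooth-mix h R with κ (inside ∷ R) in e | κ (outside ∷ R) in e′
    ... | just zero    | just zero    = mix-const q₀ _
    ... | just zero    | nothing      with () ← ≡.trans (≡.sym (κ-inv _ zero outside e)) e′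
    ... | just zero    | just (suc _) with () ← ≡.trans (≡.sym (κ-inv _ zero outside e)) e′
    ... | nothing      | just zero    with () ← ≡.trans (≡.sym (κ-inv _ zero inside e′)) e
    ... | just (suc _) | just zero    with () ← ≡.trans (≡.sym (κ-inv _ zero inside e′)) e
    ... | nothing      | nothing      = refl
    ... | nothing      | just (suc _) = refl
    ... | just (suc _) | nothing      = refl
    ... | just (suc _) | just (suc _) = refl

    average-smooth : ∀ h → mix q₀ (average q′ (slice h inside)) (average q′ (slice h outside))
                           ≈ average q h
    average-smooth h = trans (sym (average-mix q′ q₀ _ _))
      (trans (average-cong q′ (smooth-mix h)) (average-mix q′ q₀ _ _))

    slice-nothing : ∀ b R → lower (κ (b ∷ R)) ≡ nothing → slice f b R ≤ slice g b R
    slice-nothing b R _ with κ (b ∷ R) in e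
    slice-nothing b R _  | nothing   = f≤g (b ∷ R) e
    slice-nothing b R _  | just zero = f≤ʲg (b ∷ R) zero e
    slice-nothing b R () | just (suc _)

    slice-suc : ∀ h b R {j} → κ (b ∷ R) ≡ just (suc j) → slice h b R ≡ h (b ∷ R)
    slice-suc h b R e rewrite e = ≡.refl

    slice-mono : ∀ b → average q′ (slice f b) ≤ average q′ (slice g b)
    -- With the head fixed at b, the induction hypothesis applies to the lowered selection. Changing
    -- a selected tail coordinate keeps it selected, so both entries compared there are unsmoothed.
    slice-mono b = average-mono (0≤q ∘ suc) (q≤1 ∘ suc) (λ R → lower (κ (b ∷ R)))
      (λ R j x e → ≡.cong lower (κ-inv (b ∷ R) (suc j) x (lower⁻ _ e)))
      (slice-nothing b)
      λ R j e → let e′ = lower⁻ (κ (b ∷ R)) e in ≡.subst₂ _≤_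
        (≡.sym (≡.cong₂ (mix (q (suc j)))
          (slice-suc f b _ (κ-inv (b ∷ R) (suc j) inside e′))
          (slice-suc f b _ (κ-inv (b ∷ R) (suc j) outside e′))))
        (≡.sym (≡.cong₂ (mix (q (suc j)))
          (slice-suc g b _ (κ-inv (b ∷ R) (suc j) inside e′))
          (slice-suc g b _ (κ-inv (b ∷ R) (suc j) outside e′))))
        (f≤ʲg (b ∷ R) (suc j) e′)

-- The potential: total reward of B minus A.

module Potential {c ℓ₁ ℓ₂} (K : OrderedField c ℓ₁ ℓ₂) where

  open OrderedField K hiding (zero)
  open OrderedFieldProperties K
  open SemiringSolver commutativeSemiring

  missing : ∀ {N} → (Fin N → Carrier) → Subset N → Subset N → Carrier
  missing r []            []            = 0#
  missing r (outside ∷ A) (inside  ∷ B) = r zero + missing (r ∘ suc) A B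
  missing r (inside  ∷ A) (_       ∷ B) = missing (r ∘ suc) A B
  missing r (outside ∷ A) (outside ∷ B) = missing (r ∘ suc) A B

  missing-self : ∀ {N} (r : Fin N → Carrier) A → missing r A A ≈ 0#
  missing-self r []            = refl
  missing-self r (inside  ∷ A) = missing-self (r ∘ suc) A
  missing-self r (outside ∷ A) = missing-self (r ∘ suc) A

  missing-nonNeg : ∀ {N} {r : Fin N → Carrier} → (∀ i → 0# ≤ r i) → ∀ A B → 0# ≤ missing r A B
  missing-nonNeg 0≤r []            []            = ≤-refl
  missing-nonNeg 0≤r (inside  ∷ A) (_       ∷ B) = missing-nonNeg (0≤r ∘ suc) A B
  missing-nonNeg 0≤r (outside ∷ A) (inside  ∷ B) =
    ≤-trans (missing-nonNeg (0≤r ∘ suc) A B) (x≤y+x (0≤r zero))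
  missing-nonNeg 0≤r (outside ∷ A) (outside ∷ B) = missing-nonNeg (0≤r ∘ suc) A B

  -- Returns common to both runs can only shrink the difference of the two sets.
  missing-∪ : ∀ {N} {r : Fin N → Carrier} → (∀ i → 0# ≤ r i) → ∀ A B R →
    missing r (A ∪ R) (B ∪ R) ≤ missing r A B
  missing-∪ 0≤r []            []            []            = ≤-refl
  missing-∪ 0≤r (inside  ∷ A) (_       ∷ B) (_       ∷ R) = missing-∪ (0≤r ∘ suc) A B R
  missing-∪ 0≤r (outside ∷ A) (inside  ∷ B) (inside  ∷ R) =
    ≤-trans (missing-∪ (0≤r ∘ suc) A B R) (x≤y+x (0≤r zero))
  missing-∪ 0≤r (outside ∷ A) (inside  ∷ B) (outside ∷ R) =
    +-monoʳ-≤ _ (missing-∪ (0≤r ∘ suc) A B R)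
  missing-∪ 0≤r (outside ∷ A) (outside ∷ B) (inside  ∷ R) = missing-∪ (0≤r ∘ suc) A B R
  missing-∪ 0≤r (outside ∷ A) (outside ∷ B) (outside ∷ R) = missing-∪ (0≤r ∘ suc) A B R

  missing-removeˡ : ∀ {N} {r : Fin N → Carrier} → (∀ i → 0# ≤ r i) → ∀ i A B →
    missing r (A [ i ]≔ outside) B ≤ r i + missing r A B
  missing-removeˡ 0≤r zero    (inside  ∷ A) (inside  ∷ B) = ≤-refl
  missing-removeˡ 0≤r zero    (inside  ∷ A) (outside ∷ B) = x≤y+x (0≤r zero)
  missing-removeˡ 0≤r zero    (outside ∷ A) (_       ∷ B) = x≤y+x (0≤r zero)
  missing-removeˡ 0≤r (suc i) (inside  ∷ A) (_       ∷ B) = missing-removeˡ (0≤r ∘ suc) i A B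
  missing-removeˡ 0≤r (suc i) (outside ∷ A) (outside ∷ B) = missing-removeˡ (0≤r ∘ suc) i A B
  missing-removeˡ {r = r} 0≤r (suc i) (outside ∷ A) (inside ∷ B) = ≤-trans
    (+-monoʳ-≤ _ (missing-removeˡ (0≤r ∘ suc) i A B))
    (≤-reflexive (solve 3 (λ x y z → x :+ (y :+ z) := y :+ (x :+ z)) refl
      (r zero) (r (suc i)) (missing (r ∘ suc) A B)))

  missing-removeʳ : ∀ {N} {r : Fin N → Carrier} → (∀ i → 0# ≤ r i) → ∀ i A B →
    missing r A (B [ i ]≔ outside) ≤ missing r A B
  missing-removeʳ 0≤r zero    (inside  ∷ A) (_       ∷ B) = ≤-refl
  missing-removeʳ 0≤r zero    (outside ∷ A) (inside  ∷ B) = x≤y+x (0≤r zero)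
  missing-removeʳ 0≤r zero    (outside ∷ A) (outside ∷ B) = ≤-refl
  missing-removeʳ 0≤r (suc i) (inside  ∷ A) (_       ∷ B) = missing-removeʳ (0≤r ∘ suc) i A B
  missing-removeʳ 0≤r (suc i) (outside ∷ A) (inside  ∷ B) =
    +-monoʳ-≤ _ (missing-removeʳ (0≤r ∘ suc) i A B)
  missing-removeʳ 0≤r (suc i) (outside ∷ A) (outside ∷ B) = missing-removeʳ (0≤r ∘ suc) i A B

  -- Once i has left B, its presence in A is immaterial. This serves the case in which both runs
  -- match i.
  missing-remove : ∀ {N} (r : Fin N → Carrier) i A B →
    missing r (A [ i ]≔ outside) (B [ i ]≔ outside) ≈ missing r A (B [ i ]≔ outside)
  missing-remove r zero    (inside  ∷ A) (_       ∷ B) = refl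
  missing-remove r zero    (outside ∷ A) (_       ∷ B) = refl
  missing-remove r (suc i) (inside  ∷ A) (_       ∷ B) = missing-remove (r ∘ suc) i A B
  missing-remove r (suc i) (outside ∷ A) (inside  ∷ B) = +-congˡ (missing-remove (r ∘ suc) i A B)
  missing-remove r (suc i) (outside ∷ A) (outside ∷ B) = missing-remove (r ∘ suc) i A B

  missing-removeʳ-∈ : ∀ {N} (r : Fin N → Carrier) {i A B} → i ∈ B → i ∉ A →
    r i + missing r A (B [ i ]≔ outside) ≈ missing r A B
  missing-removeʳ-∈ r {A = inside  ∷ A} {B}           here        i∉A = ⊥-elim (i∉A here)
  missing-removeʳ-∈ r {A = outside ∷ A} {inside ∷ B}  here        i∉A = refl
  missing-removeʳ-∈ r {A = inside  ∷ A} {_ ∷ B}       (there i∈B) i∉A =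
    missing-removeʳ-∈ (r ∘ suc) i∈B (i∉A ∘ there)
  missing-removeʳ-∈ r {suc i} {outside ∷ A} {inside ∷ B} (there i∈B) i∉A = trans
    (solve 3 (λ x y z → y :+ (x :+ z) := x :+ (y :+ z)) refl
      (r zero) (r (suc i)) (missing (r ∘ suc) A (B [ i ]≔ outside)))
    (+-congˡ (missing-removeʳ-∈ (r ∘ suc) i∈B (i∉A ∘ there)))
  missing-removeʳ-∈ r {A = outside ∷ A} {outside ∷ B} (there i∈B) i∉A =
    missing-removeʳ-∈ (r ∘ suc) i∈B (i∉A ∘ there)

  -- The sum for A and B contains the term `r i`, while i contributes nothing after its match; this
  -- is so even if i belongs to R. All other terms can only disappear through the returns.
  missing-∪-removeʳ : ∀ {N} {r : Fin N → Carrier} → (∀ i → 0# ≤ r i) → ∀ {i A B} R →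
    i ∈ B → i ∉ A → r i + missing r (A ∪ R) ((B ∪ R) [ i ]≔ outside) ≤ missing r A B
  missing-∪-removeʳ {r = r} 0≤r {i} {A} {B} R i∈B i∉A = ≤-trans
    (+-monoʳ-≤ _ (shrink 0≤r i A B R)) (≤-reflexive (missing-removeʳ-∈ r i∈B i∉A))
    where
    shrink : ∀ {N} {r : Fin N → Carrier} → (∀ i → 0# ≤ r i) → ∀ i A B R →
      missing r (A ∪ R) ((B ∪ R) [ i ]≔ outside) ≤ missing r A (B [ i ]≔ outside)
    shrink 0≤r zero    (inside  ∷ A) (_       ∷ B) (_       ∷ R) = missing-∪ (0≤r ∘ suc) A B R
    shrink 0≤r zero    (outside ∷ A) (_       ∷ B) (inside  ∷ R) = missing-∪ (0≤r ∘ suc) A B R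
    shrink 0≤r zero    (outside ∷ A) (_       ∷ B) (outside ∷ R) = missing-∪ (0≤r ∘ suc) A B R
    shrink 0≤r (suc i) (inside  ∷ A) (_       ∷ B) (_       ∷ R) = shrink (0≤r ∘ suc) i A B R
    shrink 0≤r (suc i) (outside ∷ A) (inside  ∷ B) (inside  ∷ R) =
      ≤-trans (shrink (0≤r ∘ suc) i A B R) (x≤y+x (0≤r zero))
    shrink 0≤r (suc i) (outside ∷ A) (inside  ∷ B) (outside ∷ R) =
      +-monoʳ-≤ _ (shrink (0≤r ∘ suc) i A B R)
    shrink 0≤r (suc i) (outside ∷ A) (outside ∷ B) (inside  ∷ R) = shrink (0≤r ∘ suc) i A B R
    shrink 0≤r (suc i) (outside ∷ A) (outside ∷ B) (outside ∷ R) = shrink (0≤r ∘ suc) i A B R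

-- Greedy's choice and the return of a single resource.

highest-max : ∀ {N} (S : Subset N) {i} → i ∈ S →
  ∃ λ g → ∃ λ g∈S → highest S ≡ just (g , g∈S) × i Fin.≤ g
highest-max (s ∷ S) (there i∈S) with highest S | highest-max S i∈S
... | _ | g , g∈S , ≡.refl , i≤g = suc g , there g∈S , ≡.refl , s≤s i≤g
highest-max (inside ∷ S) here with highest S
... | just (g , g∈S) = suc g , there g∈S , ≡.refl , z≤n
... | nothing        = zero , here , ≡.refl , z≤n

-- The policy cannot see the return coin of a resource it already has; hence its choice of j is
-- independent of whether j returns to greedy.
∪-[]≔ : ∀ {N} {B : Subset N} {j} → j ∈ B → ∀ R b → B ∪ (R [ j ]≔ b) ≡ B ∪ R
∪-[]≔ here            (_ ∷ R) b = ≡.refl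
∪-[]≔ {B = s ∷ _} (there j∈B) (x ∷ R) b = ≡.cong (_ ∷_) (∪-[]≔ j∈B R b)

-- The coin of j affects only j, so whatever else greedy could take remains available when j fails
-- to return.
∈-outside : ∀ {N} (S A R : Subset N) {i j} → i ∈ S ∩ (A ∪ (R [ j ]≔ inside)) → ¬ (i ≡ j) →
  i ∈ S ∩ (A ∪ (R [ j ]≔ outside))
∈-outside S A R {i} {j} i∈ i≢j with x∈p∩q⁻ S _ i∈
... | i∈S , i∈A∪R⁺ with x∈p∪q⁻ A _ i∈A∪R⁺
... | inj₁ i∈A  = x∈p∩q⁺ (i∈S , x∈p∪q⁺ (inj₁ i∈A))
... | inj₂ i∈R⁺ = x∈p∩q⁺ (i∈S , x∈p∪q⁺ (inj₂
  (≡.subst (i ∈_) ([]≔-idempotent R j) ([]≔-minimal (R [ j ]≔ inside) i j i≢j i∈R⁺))))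

-- Exchange inequalities and the coupled induction.

module GreedyBound {c ℓ₁ ℓ₂} (K : OrderedField c ℓ₁ ℓ₂) where

  open OrderedField K hiding (zero)
  open OrderedFieldProperties K
  open Mixture K
  open Markov K
  open Averaging K
  open Potential K
  open SemiringSolver commutativeSemiring

  module WithRates {N : ℕ}
    (r q : Fin N → Carrier) (p : Carrier)
    (0≤r : ∀ i → 0# ≤ r i) (r-mono : ∀ {i j} → i Fin.≤ j → r i ≤ r j)
    (0≤q : ∀ i → 0# ≤ q i) (q≤1 : ∀ i → q i ≤ 1#)
    (0≤p : 0# ≤ p) (p≤1 : p ≤ 1#) (p≤q : ∀ i → p ≤ q i)
    where

    private
      p̄ : Carrier
      p̄ = 1# - p

      p+p̄≈1 : p + p̄ ≈ 1#
      p+p̄≈1 = x+[y-x]≈y p 1#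

      0≤p̄ : 0# ≤ p̄
      0≤p̄ = x≤y⇒0≤y-x p≤1

      0≤1+p : 0# ≤ 1# + p
      0≤1+p = ≤-trans 0≤p (x≤y+x 0≤1)

    -- In the three exchange lemmas below x and y are the rewards of the policy and of greedy, v is
    -- greedy's future value, and φ, φ′ are the potentials before and after the match.
    exchange : ∀ {x y v φ φ′} → x ≤ y → φ′ ≤ y + φ →
      (1# + p) * x + (2# * v + p̄ * φ′) ≤ 2# * (y + v) + p̄ * φ
    exchange {x} {y} {v} {φ} {φ′} x≤y φ′≤y+φ = begin
      (1# + p) * x + (2# * v + p̄ * φ′)
        -- Greedy's 2y splits into (1 + p) y for the policy's reward and (1 - p) y for the growth of
        -- the potential.
        ≤⟨ +-mono-≤ (*-monoʳ-≤ 0≤1+p x≤y) (+-monoʳ-≤ _ (*-monoʳ-≤ 0≤p̄ φ′≤y+φ)) ⟩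
      (1# + p) * y + (2# * v + p̄ * (y + φ))
        ≈⟨ solve 5 (λ p p̄ y v φ →
             (con 1 :+ p) :* y :+ (con 2 :* v :+ p̄ :* (y :+ φ))
             := (con 1 :+ (p :+ p̄)) :* y :+ (con 2 :* v :+ p̄ :* φ)) refl p p̄ y v φ ⟩
      (1# + (p + p̄)) * y + (2# * v + p̄ * φ)
        ≈⟨ +-congʳ (*-congʳ (+-congˡ p+p̄≈1)) ⟩
      2# * y + (2# * v + p̄ * φ)
        ≈⟨ solve 4 (λ p̄ y v φ → con 2 :* y :+ (con 2 :* v :+ p̄ :* φ)
                                := con 2 :* (y :+ v) :+ p̄ :* φ) refl p̄ y v φ ⟩
      2# * (y + v) + p̄ * φ ∎
      where open ≤-Reasoning poset

    -- The potential releases (1 - p) x towards the policy's (1 + p) x, which leaves 2px uncovered.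
    exchange-deficit : ∀ {x y v φ φ′} → 0# ≤ y → x + φ′ ≤ y + φ →
      (1# + p) * x + (2# * v + p̄ * φ′) ≤ (2# * (y + v) + p̄ * φ) + 2# * (p * x)
    exchange-deficit {x} {y} {v} {φ} {φ′} 0≤y x+φ′≤y+φ = begin
      (1# + p) * x + (2# * v + p̄ * φ′)
        ≈⟨ +-congʳ (*-congʳ (+-congʳ p+p̄≈1)) ⟨
      ((p + p̄) + p) * x + (2# * v + p̄ * φ′)
        ≈⟨ solve 5 (λ p p̄ x v φ′ → ((p :+ p̄) :+ p) :* x :+ (con 2 :* v :+ p̄ :* φ′)
             := p̄ :* (x :+ φ′) :+ (con 2 :* v :+ con 2 :* (p :* x))) refl p p̄ x v φ′ ⟩
      p̄ * (x + φ′) + (2# * v + 2# * (p * x))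
        ≤⟨ +-monoˡ-≤ _ (*-monoʳ-≤ 0≤p̄ x+φ′≤y+φ) ⟩
      p̄ * (y + φ) + (2# * v + 2# * (p * x))
        ≤⟨ x≤y+x (*-nonNegative 0≤1+p 0≤y) ⟩
      (1# + p) * y + (p̄ * (y + φ) + (2# * v + 2# * (p * x)))
        ≈⟨ solve 6 (λ p p̄ x y v φ →
             (con 1 :+ p) :* y :+ (p̄ :* (y :+ φ) :+ (con 2 :* v :+ con 2 :* (p :* x)))
             := (con 1 :+ (p :+ p̄)) :* y :+ (con 2 :* v :+ p̄ :* φ :+ con 2 :* (p :* x)))
             refl p p̄ x y v φ ⟩
      (1# + (p + p̄)) * y + (2# * v + p̄ * φ + 2# * (p * x))
        ≈⟨ +-congʳ (*-congʳ (+-congˡ p+p̄≈1)) ⟩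
      2# * y + (2# * v + p̄ * φ + 2# * (p * x))
        ≈⟨ solve 6 (λ p p̄ x y v φ →
             con 2 :* y :+ (con 2 :* v :+ p̄ :* φ :+ con 2 :* (p :* x))
             := (con 2 :* (y :+ v) :+ p̄ :* φ) :+ con 2 :* (p :* x)) refl p p̄ x y v φ ⟩
      (2# * (y + v) + p̄ * φ) + 2# * (p * x) ∎
      where open ≤-Reasoning poset

    -- Both runs earn x: greedy's 2x and the released (1 - p) x exceed the policy's (1 + p) x by 2(1
    -- - p) x.
    exchange-surplus : ∀ {x v φ φ′} → x + φ′ ≤ φ →
      ((1# + p) * x + (2# * v + p̄ * φ′)) + 2# * (p̄ * x) ≤ 2# * (x + v) + p̄ * φ
    exchange-surplus {x} {v} {φ} {φ′} x+φ′≤φ = begin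
      ((1# + p) * x + (2# * v + p̄ * φ′)) + 2# * (p̄ * x)
        ≈⟨ solve 5 (λ p p̄ x v φ′ →
             ((con 1 :+ p) :* x :+ (con 2 :* v :+ p̄ :* φ′)) :+ con 2 :* (p̄ :* x)
             := ((con 1 :+ (p :+ p̄)) :* x :+ con 2 :* v) :+ p̄ :* (x :+ φ′)) refl p p̄ x v φ′ ⟩
      ((1# + (p + p̄)) * x + 2# * v) + p̄ * (x + φ′)
        ≤⟨ +-monoʳ-≤ _ (*-monoʳ-≤ 0≤p̄ x+φ′≤φ) ⟩
      ((1# + (p + p̄)) * x + 2# * v) + p̄ * φ
        ≈⟨ +-congʳ (+-congʳ (*-congʳ (+-congˡ p+p̄≈1))) ⟩
      (2# * x + 2# * v) + p̄ * φ
        ≈⟨ +-congʳ (distribˡ 2# x v) ⟨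
      2# * (x + v) + p̄ * φ ∎
      where open ≤-Reasoning poset

    -- The surplus has probability a and the deficit 1 - a; from p ≤ a follows (1 - a) p ≤ (1 - p)
    -- a, so the surplus pays on average.
    mix-balance : ∀ {a x f⁺ f⁻ h⁺ h⁻} → 0# ≤ a → a ≤ 1# → p ≤ a → 0# ≤ x →
      f⁺ + 2# * (p̄ * x) ≤ h⁺ → f⁻ ≤ h⁻ + 2# * (p * x) → mix a f⁺ f⁻ ≤ mix a h⁺ h⁻
    mix-balance {a} {x} {f⁺} {f⁻} {h⁺} {h⁻} 0≤a a≤1 p≤a 0≤x surplus deficit = begin
      a * f⁺ + ā * f⁻
        ≤⟨ +-monoʳ-≤ _ (*-monoʳ-≤ 0≤ā deficit) ⟩
      a * f⁺ + ā * (h⁻ + 2# * (p * x))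
        ≈⟨ solve 6 (λ a ā f h p x → a :* f :+ ā :* (h :+ con 2 :* (p :* x))
                                    := (a :* f :+ ā :* h) :+ con 2 :* ((ā :* p) :* x))
             refl a ā f⁺ h⁻ p x ⟩
      (a * f⁺ + ā * h⁻) + 2# * ((ā * p) * x)
        ≤⟨ +-monoʳ-≤ _ (*-monoʳ-≤ 0≤2 (*-monoˡ-≤ 0≤x āp≤p̄a)) ⟩
      (a * f⁺ + ā * h⁻) + 2# * ((p̄ * a) * x)
        ≈⟨ solve 6 (λ a ā f h p̄ x → (a :* f :+ ā :* h) :+ con 2 :* ((p̄ :* a) :* x)
                                    := a :* (f :+ con 2 :* (p̄ :* x)) :+ ā :* h)
             refl a ā f⁺ h⁻ p̄ x ⟩
      a * (f⁺ + 2# * (p̄ * x)) + ā * h⁻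
        ≤⟨ +-monoˡ-≤ _ (*-monoʳ-≤ 0≤a surplus) ⟩
      a * h⁺ + ā * h⁻ ∎
      where
      open ≤-Reasoning poset
      ā = 1# - a
      0≤ā : 0# ≤ ā
      0≤ā = x≤y⇒0≤y-x a≤1
      ā≤p̄ : ā ≤ p̄
      ā≤p̄ = begin
        ā                 ≤⟨ x≤y+x (x≤y⇒0≤y-x p≤a) ⟩
        (a - p) + ā       ≈⟨ solve 3 (λ a n ā → (a :+ n) :+ ā := (a :+ ā) :+ n) refl a (- p) ā ⟩
        (a + ā) - p       ≈⟨ +-congʳ (x+[y-x]≈y a 1#) ⟩
        p̄                 ∎
      āp≤p̄a : ā * p ≤ p̄ * a
      āp≤p̄a = ≤-trans (*-monoʳ-≤ 0≤ā p≤a) (*-monoˡ-≤ 0≤a ā≤p̄)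

    gain-nonNeg : ∀ {S : Subset N} (d : Choice S) → 0# ≤ gain r d
    gain-nonNeg nothing        = ≤-refl
    gain-nonNeg (just (i , _)) = 0≤r i

    gain-highest : ∀ (S : Subset N) {i} → i ∈ S → r i ≤ gain r (highest S)
    gain-highest S i∈S with highest S | highest-max S i∈S
    ... | _ | g , _ , ≡.refl , i≤g = r-mono i≤g

    missing-remove-greedy : ∀ {S : Subset N} (g : Choice S) A B →
      missing r (remove g A) B ≤ gain r g + missing r A B
    missing-remove-greedy nothing        A B = x≤y+x ≤-refl
    missing-remove-greedy (just (i , _)) A B = missing-removeˡ 0≤r i A B

    missing-remove-policy : ∀ {S : Subset N} (d : Choice S) A B →
      missing r A (remove d B) ≤ missing r A B
    missing-remove-policy nothing        A B = ≤-refl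
    missing-remove-policy (just (i , _)) A B = missing-removeʳ 0≤r i A B

    -- The choices of the policy to be paid for by the potential.
    contested : ∀ (A B : Subset N) {S : Subset N} → Choice S → Maybe (Fin N)
    contested A B nothing = nothing
    contested A B (just (j , _)) with j ∈? B | j ∈? A
    ... | yes _ | no _ = just j
    ... | _     | _    = nothing

    contested-just : ∀ A B {S : Subset N} (d : Choice S) {j} → contested A B d ≡ just j →
      (∃ λ j∈S → d ≡ just (j , j∈S)) × j ∈ B × j ∉ A
    contested-just A B (just (j , j∈S)) e with j ∈? B | j ∈? A
    contested-just A B (just (j , j∈S)) ≡.refl | yes j∈B | no j∉A = (j∈S , ≡.refl) , j∈B , j∉A
    contested-just A B (just (j , j∈S)) () | yes _ | yes _
    contested-just A B (just (j , j∈S)) () | no _  | _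

    -- An uncontested match lies in A or among the common returns R, so greedy could make it as
    -- well.
    uncontested⇒gain≤ : ∀ S A B R (d : Choice (S ∩ (B ∪ R))) → contested A B d ≡ nothing →
      gain r d ≤ gain r (highest (S ∩ (A ∪ R)))
    uncontested⇒gain≤ S A B R nothing            e = gain-nonNeg (highest (S ∩ (A ∪ R)))
    uncontested⇒gain≤ S A B R (just (j , j∈S∩B′)) e
      with j ∈? B | j ∈? A | x∈p∩q⁻ S (B ∪ R) j∈S∩B′
    uncontested⇒gain≤ S A B R (just (j , _)) () | yes _ | no _ | _
    ... | yes _  | yes j∈A | j∈S , _ = gain-highest _ (x∈p∩q⁺ (j∈S , x∈p∪q⁺ (inj₁ j∈A)))
    ... | no j∉B | _ | j∈S , j∈B′ with x∈p∪q⁻ B R j∈B′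
    ... | inj₁ j∈B = ⊥-elim (j∉B j∈B)
    ... | inj₂ j∈R = gain-highest _ (x∈p∩q⁺ (j∈S , x∈p∪q⁺ (inj₂ j∈R)))

    -- A and B are arbitrary because the two runs drift apart. Both averages run over the same R,
    -- which is the coupling of the returns.
    greedy-bound : ∀ {T} (G : Vec (Subset N) T) (π : Policy G) A B →
      (1# + p) * value r q G π B ≤ 2# * value r q G (greedy G) A + p̄ * missing r A B
    greedy-bound [] π A B = begin
      (1# + p) * 0#              ≈⟨ zeroʳ _ ⟩
      0#                         ≤⟨ *-nonNegative 0≤p̄ (missing-nonNeg 0≤r A B) ⟩
      p̄ * missing r A B          ≈⟨ +-identityˡ _ ⟨
      0# + p̄ * missing r A B     ≈⟨ +-congʳ (zeroʳ 2#) ⟨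
      2# * 0# + p̄ * missing r A B ∎
      where open ≤-Reasoning poset
    greedy-bound (S ∷ G) π A B = begin
      (1# + p) * average q (λ R → policyStep R (choice R) (rest R))
        ≈⟨ +-identityʳ _ ⟨
      (1# + p) * average q (λ R → policyStep R (choice R) (rest R)) + 0#
        ≈⟨ average-affine q (1# + p) 0# _ ⟨
      average q (λ R → (1# + p) * policyStep R (choice R) (rest R) + 0#)
        ≈⟨ average-cong q (λ R → +-identityʳ _) ⟩
      average q lhs
        ≤⟨ average-mono 0≤q q≤1 κ κ-invariant
             (λ R e → dominated R (choice R) (rest R) (uncontested⇒gain≤ S A B R (choice R) e)) paired ⟩
      average q (λ R → rhs R (highest (S ∩ (A ∪ R))))
        ≈⟨ average-affine q 2# (p̄ * missing r A B) _ ⟩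
      2# * value r q (S ∷ G) (greedy (S ∷ G)) A + p̄ * missing r A B ∎
      where
      open ≤-Reasoning poset

      choice : ∀ R → Choice (S ∩ (B ∪ R))
      choice R = proj₁ (π (B ∪ R))

      rest : Subset N → Policy G
      rest R = proj₂ (π (B ∪ R))

      policyStep : ∀ R → Choice (S ∩ (B ∪ R)) → Policy G → Carrier
      policyStep R d π′ = gain r d + value r q G π′ (remove d (B ∪ R))

      lhs : Subset N → Carrier
      lhs R = (1# + p) * policyStep R (choice R) (rest R)

      rhs : ∀ R → Choice (S ∩ (A ∪ R)) → Carrier
      rhs R g = 2# * (gain r g + value r q G (greedy G) (remove g (A ∪ R))) + p̄ * missing r A B

      κ : Subset N → Maybe (Fin N)
      κ R = contested A B (choice R)

      κ-invariant : ∀ R j b → κ R ≡ just j → κ (R [ j ]≔ b) ≡ just j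
      κ-invariant R j b e with contested-just A B (choice R) e
      ... | _ , j∈B , _ =
        ≡.trans (≡.cong (λ X → contested A B (proj₁ (π X))) (∪-[]≔ j∈B R b)) e

      induct : ∀ R (d : Choice (S ∩ (B ∪ R))) π′ (g : Choice (S ∩ (A ∪ R))) →
        (1# + p) * policyStep R d π′
        ≤ (1# + p) * gain r d + (2# * value r q G (greedy G) (remove g (A ∪ R))
                                 + p̄ * missing r (remove g (A ∪ R)) (remove d (B ∪ R)))
      induct R d π′ g = ≤-trans (≤-reflexive (distribˡ _ _ _))
        (+-monoʳ-≤ _ (greedy-bound G π′ (remove g (A ∪ R)) (remove d (B ∪ R))))

      dominated : ∀ R (d : Choice (S ∩ (B ∪ R))) π′ → gain r d ≤ gain r (highest (S ∩ (A ∪ R))) →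
        (1# + p) * policyStep R d π′ ≤ rhs R (highest (S ∩ (A ∪ R)))
      dominated R d π′ d≤g = ≤-trans (induct R d π′ g) (exchange d≤g
        (≤-trans (missing-remove-greedy g (A ∪ R) (remove d (B ∪ R)))
          (+-monoʳ-≤ _ (≤-trans (missing-remove-policy d (A ∪ R) (B ∪ R)) (missing-∪ 0≤r A B R)))))
        where g = highest (S ∩ (A ∪ R))

      deficit : ∀ R (d : Choice (S ∩ (B ∪ R))) π′ {j j∈} → d ≡ just (j , j∈) → j ∈ B → j ∉ A → ∀ g →
        (1# + p) * policyStep R d π′ ≤ rhs R g + 2# * (p * r j)
      deficit R d π′ {j} ≡.refl j∈B j∉A g = ≤-trans (induct R d π′ g)
        (exchange-deficit (gain-nonNeg g) (begin
          r j + missing r (remove g (A ∪ R)) B″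
            ≤⟨ +-monoʳ-≤ _ (missing-remove-greedy g (A ∪ R) B″) ⟩
          r j + (gain r g + missing r (A ∪ R) B″)
            ≈⟨ solve 3 (λ x y z → x :+ (y :+ z) := y :+ (x :+ z)) refl _ _ _ ⟩
          gain r g + (r j + missing r (A ∪ R) B″)
            ≤⟨ +-monoʳ-≤ _ (missing-∪-removeʳ 0≤r R j∈B j∉A) ⟩
          gain r g + missing r A B ∎))
        where B″ = (B ∪ R) [ j ]≔ outside

      surplus : ∀ R (d : Choice (S ∩ (B ∪ R))) π′ {j j∈} → d ≡ just (j , j∈) → j ∈ B → j ∉ A →
        ∀ g {g∈} → g ≡ just (j , g∈) →
        (1# + p) * policyStep R d π′ + 2# * (p̄ * r j) ≤ rhs R g
      surplus R d π′ {j} ≡.refl j∈B j∉A g ≡.refl = ≤-trans (+-monoˡ-≤ _ (induct R d π′ g))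
        (exchange-surplus (≤-trans
          (+-monoʳ-≤ _ (≤-reflexive (missing-remove r j (A ∪ R) (B ∪ R))))
          (missing-∪-removeʳ 0≤r R j∈B j∉A)))

      paired : ∀ R j → κ R ≡ just j →
        mix (q j) (lhs (R [ j ]≔ inside)) (lhs (R [ j ]≔ outside))
        ≤ mix (q j) (rhs (R [ j ]≔ inside) (highest (S ∩ (A ∪ (R [ j ]≔ inside)))))
                    (rhs (R [ j ]≔ outside) (highest (S ∩ (A ∪ (R [ j ]≔ outside)))))
      paired R j e
        with contested-just A B (choice (R [ j ]≔ inside)) (κ-invariant R j inside e)
           | contested-just A B (choice (R [ j ]≔ outside)) (κ-invariant R j outside e)
      ... | (j∈ , e⁺) , j∈B , j∉A | (_ , e⁻) , _
        -- If j returns, greedy can take it, so its choice g has index at least j.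
        with highest-max (S ∩ (A ∪ (R [ j ]≔ inside)))
               (x∈p∩q⁺ (proj₁ (x∈p∩q⁻ S _ j∈) , x∈p∪q⁺ (inj₂ ([]≔-updates R j))))
      ... | g , g∈ , eg , j≤g with g Finₚ.≟ j
      -- Greedy takes j upon its return: a surplus with probability `q j`, a deficit otherwise.
      ... | yes ≡.refl = mix-balance (0≤q j) (q≤1 j) (p≤q j) (0≤r j)
        (surplus R⁺ (choice R⁺) (rest R⁺) e⁺ j∈B j∉A (highest (S ∩ (A ∪ R⁺))) eg)
        (deficit R⁻ (choice R⁻) (rest R⁻) e⁻ j∈B j∉A (highest (S ∩ (A ∪ R⁻))))
        where
        R⁺ = R [ j ]≔ inside
        R⁻ = R [ j ]≔ outside
      -- Greedy prefers another g, which it can take whether or not j returns, so it earns at least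
      -- `r j` either way.
      ... | no g≢j = mix-mono (0≤q j) (q≤1 j)
        (dominated R⁺ (choice R⁺) (rest R⁺) (begin
          gain r (choice R⁺)               ≡⟨ ≡.cong (gain r) e⁺ ⟩
          r j                              ≤⟨ r-mono j≤g ⟩
          r g                              ≡⟨ ≡.cong (gain r) eg ⟨
          gain r (highest (S ∩ (A ∪ R⁺)))  ∎))
        (dominated R⁻ (choice R⁻) (rest R⁻) (begin
          gain r (choice R⁻)               ≡⟨ ≡.cong (gain r) e⁻ ⟩
          r j                              ≤⟨ r-mono j≤g ⟩
          r g                              ≤⟨ gain-highest _ (∈-outside S A R g∈ g≢j) ⟩
          gain r (highest (S ∩ (A ∪ R⁻)))  ∎))
        where
        R⁺ = R [ j ]≔ inside
        R⁻ = R [ j ]≔ outside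

theorem2 : ∀ {c ℓ₁ ℓ₂} (K : OrderedField c ℓ₁ ℓ₂) →
    let open OrderedField K
        open Matching K
    in
    ∀ {N T : ℕ} (I : Instance N T) (pᵢ : Fin N → Carrier) →
    (∀ i → IsGeometric (Instance.F I i) (pᵢ i)) →
    ∀ p → IsMinimum pᵢ p →
    ((1# + p) / 2#) * OPT I ≤ Greedy I
theorem2 K I pᵢ geo p ((i₀ , p≈pᵢ) , p≤pᵢ) = 2*-cancel-≤ (begin
  2# * (((1# + p) / 2#) * OPT I)
    ≈⟨ *-assoc _ _ _ ⟨
  (2# * ((1# + p) / 2#)) * OPT I
    ≈⟨ *-congʳ (2*[x/2]≈x (1# + p)) ⟩
  (1# + p) * OPT I
    ≈⟨ *-congˡ (rewardFrom≈value r pᵢ F geo G π*) ⟩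
  (1# + p) * value r pᵢ G π* full
    -- Both runs start with all resources, where the potential vanishes.
    ≤⟨ greedy-bound G π* full full ⟩
  2# * value r pᵢ G (greedy G) full + (1# - p) * missing r full full
    ≈⟨ +-cong (*-congˡ (sym (rewardFrom≈value r pᵢ F geo G (greedy G))))
              (trans (*-congˡ (missing-self r full)) (zeroʳ _)) ⟩
  2# * Greedy I + 0#
    ≈⟨ +-identityʳ _ ⟩
  2# * Greedy I ∎)
  where
  open OrderedField K
  open OrderedFieldProperties K
  open Matching K
  open Instance I
  open Markov K
  open Potential K
  open ≤-Reasoning poset
  π* = proj₁ (optimal I)
  open GreedyBound.WithRates K r pᵢ p r-nonNeg r-mono
    (λ i → IsGeometric.0≤q (geo i)) (λ i → IsGeometric.q≤1 (geo i))
    -- The bounds 0 ≤ p ≤ 1 are inherited from the index i₀ that attains the minimum.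
    (≤-respʳ-≈ (sym p≈pᵢ) (IsGeometric.0≤q (geo i₀)))
    (≤-respˡ-≈ (sym p≈pᵢ) (IsGeometric.q≤1 (geo i₀))) p≤pᵢ
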